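{- When $p<q$ are integers, the $(p,q)$-biased Star (maximum degree) game and the $(p,q)$-biased vertex-capturing game on $K_n$ are both player $2$ wins provided that $n$ is sufficiently large.
   Context: Two players, Alice (player 1, starting) and Bob (player 2), alternately colour uncoloured edges of the complete graph $K_n$, Alice in red and Bob in blue; in the $(p,q)$-biased version Alice colours $p$ edges per turn and Bob $q$ edges per turn. In the Star game, Alice's score is $a=\Delta(G[A])$ and Bob's is $b=\Delta(G[B])$, the maximum degrees of the red and blue graphs. In the vertex-capturing game, $a$ is the number of vertices for which most incident edges are red and $b$ the number of vertices for which most incident edges are blue. When $q>p$, Bob (player 2) wins if at the end $b>a$. -}

module Defs where

open import Data.Nat using (ℕ; zero; suc; _+_; _⊔_; _<_)
open import Data.Nat.Properties using (_<?_)
open import Data.Fin using (Fin) renaming (_<_ to _<ᶠ_; _<?_ to _<ᶠ?_)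
open import Data.Fin.Properties using (_≟_)
open import Data.List using (List; map; foldr)
open import Data.Nat.ListAction using (sum)
open import Data.List using (allFin) public
open import Data.Bool using (Bool; true; false; if_then_else_; _∧_)
open import Data.Product using (Σ; _×_; _,_)
open import Relation.Nullary using (¬_; Dec; yes; no)
open import Relation.Nullary.Decidable using (⌊_⌋)
open import Relation.Binary.PropositionalEquality using (_≡_; _≢_)

data Colour : Set where
  none red blue : Colour

_==ᶜ_ : Colour → Colour → Bool
none ==ᶜ none = true
red  ==ᶜ red  = true
blue ==ᶜ blue = true
_    ==ᶜ _    = false

-- A (partial) colouring of the edges of K_n.  The edge {i,j} with i < j is
-- stored at  c i j ; entries with ¬ (i < j) are irrelevant.
Colouring : ℕ → Set
Colouring n = Fin n → Fin n → Colour

blank : ∀ {n} → Colouring n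
blank _ _ = none

edgeCol : ∀ {n} → Colouring n → Fin n → Fin n → Colour
edgeCol c u v with u <ᶠ? v
... | yes _ = c u v
... | no  _ = c v u

paint : ∀ {n} → Colouring n → Fin n → Fin n → Colour → Colouring n
paint c i j x a b = if ⌊ a ≟ i ⌋ ∧ ⌊ b ≟ j ⌋ then x else c a b

Full : ∀ {n} → Colouring n → Set
Full {n} c = (i j : Fin n) → i <ᶠ j → c i j ≢ none

deg : ∀ {n} → Colouring n → Colour → Fin n → ℕ
deg {n} c x v = sum (map (λ u → if ⌊ u ≟ v ⌋ then 0
                                 else (if edgeCol c u v ==ᶜ x then 1 else 0))
                         (allFin n))

Δ : ∀ {n} → Colouring n → Colour → ℕ
Δ {n} c x = foldr _⊔_ 0 (map (deg c x) (allFin n))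

captured : ∀ {n} → Colouring n → Colour → Colour → ℕ
captured {n} c x y =
  sum (map (λ v → if ⌊ deg c y v <? deg c x v ⌋ then 1 else 0) (allFin n))

data Player : Set where
  alice bob : Player

-- Game state besides the colouring: whose turn it is and how many edges that
-- player still has to colour in the current turn (always ≥ 1 while playing).
-- Colouring the p (resp. q) edges of one turn is modelled as p (resp. q)
-- consecutive single-edge moves by the same player; when that count reaches 0
-- the turn passes to the other player with a fresh quota.  The game ends as
-- soon as every edge is coloured (so a last turn may be shorter).
--
-- BobWins p q n W c pl k : from colouring c with player pl to colour k more
-- edges in the current turn, Bob (player 2) has a strategy guaranteeing that
-- the final colouring satisfies W.  (Least fixed point = winning strategy in
-- this finite game.)
other : Player → Player
other alice = bob
other bob = alice

quota : ℕ → ℕ → Player → ℕ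
quota p q alice = p
quota p q bob = q

nextPlayer : Player → ℕ → Player
nextPlayer pl zero = other pl
nextPlayer pl (suc _) = pl

nextCount : ℕ → ℕ → Player → ℕ → ℕ
nextCount p q pl zero = quota p q (other pl)
nextCount p q pl (suc k) = suc k

data BobWins (p q n : ℕ) (W : Colouring n → Set)
     : Colouring n → Player → ℕ → Set where
  finished : ∀ {c pl k} → Full c → W c → BobWins p q n W c pl k
  aliceMove : ∀ {c} k → ¬ Full c →
    ((i j : Fin n) → i <ᶠ j → c i j ≡ none →
       BobWins p q n W (paint c i j red)
         (nextPlayer alice k) (nextCount p q alice k)) →
    BobWins p q n W c alice (suc k)
  bobMove : ∀ {c} k → ¬ Full c →
    Σ (Fin n) (λ i → Σ (Fin n) (λ j → i <ᶠ j × c i j ≡ none ×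
       BobWins p q n W (paint c i j blue)
         (nextPlayer bob k) (nextCount p q bob k))) →
    BobWins p q n W c bob (suc k)

Player2Wins : (p q n : ℕ) → (Colouring n → Set) → Set
Player2Wins p q n W = BobWins p q n W blank alice p

StarBobWin : ∀ {n} → Colouring n → Set
StarBobWin c = Δ c red < Δ c blue

CaptureBobWin : ∀ {n} → Colouring n → Set
CaptureBobWin c = captured c red blue < captured c blue red

{-# OPTIONS --safe #-}

-- Bob ensures that every vertex ends with more blue than red edges, which wins both
-- games.  Put m = p (p + 2) + p and give a vertex v the weight
--   (1 + 1/m)^(red degree) (1 - 1/(m + 2))^(blue degree),
-- an edge the sum of the weights of its ends, and the position the sum Φ of all
-- vertex weights.  Bob always takes a free edge of maximal weight.  If M bounds the
-- weights of the edges still free after his turn, that turn lowered Φ by at least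
-- q M / (m + 2), and Alice's next p edges raise it by at most p M / (m - p), which is
-- no more since q > p.  So Φ stays linear in n.  As (1 + 1/m)(1 - 1/(m + 2)) > 1, a
-- vertex whose red degree is at least its blue degree would in the end have a weight
-- exponential in n.  Multiplying weights by (m (m + 2))^(n - 1) makes them integers:
-- A^(red degree) B^(blue degree) C^(uncoloured degree).

module Submission where

open import Defs
open import Data.Bool using (Bool; false; if_then_else_)
open import Data.Fin using (Fin; zero; suc) renaming (_<_ to _<ᶠ_; _<?_ to _<ᶠ?_)
open import Data.Fin.Properties using (_≟_; <-asym; <⇒≢; <-cmp)
open import Data.List using (List; []; _∷_; map; foldr; filter; cartesianProduct)
open import Data.List.Extrema.Nat using (argmax; argmax-all; f[xs]≤f[argmax])
open import Data.List.Membership.Propositional using (_∈_)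
open import Data.List.Membership.Propositional.Properties
  using (∈-filter⁺; ∈-cartesianProduct⁺; ∈-allFin; ∈-map⁺)
open import Data.List.Properties using (map-tabulate; tabulate-cong)
open import Data.List.Relation.Unary.All as All using (All; _∷_)
open import Data.List.Relation.Unary.All.Properties using (all-filter)
open import Data.List.Relation.Unary.Any using (here; there)
open import Data.Nat
  using (ℕ; zero; suc; _+_; _*_; _^_; _⊔_; _/_; _%_; _≤_; _<_; z≤n; s≤s; NonZero)
open import Data.Nat.DivMod using (m≡m%n+[m/n]*n; m%n<n; /-monoˡ-≤; m*n/n≡m)
open import Data.Nat.ListAction using (sum)
open import Data.Nat.Properties hiding (_≟_; <-asym; <⇒≢; <-cmp)
open import Data.Nat.Tactic.RingSolver using (solve-∀)
open import Data.Product using (Σ; ∃; _×_; _,_; proj₁; proj₂)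
open import Data.Sum using (_⊎_; inj₁; inj₂)
open import Function using (id; _∘_)
open import Relation.Binary using (tri<; tri≈; tri>)
open import Relation.Binary.PropositionalEquality
  using (_≡_; _≢_; _≗_; refl; sym; trans; cong; cong₂; subst; subst₂; module ≡-Reasoning)
open import Relation.Nullary using (¬_; Dec; yes; no; contradiction)
open import Relation.Nullary.Decidable using (⌊_⌋; _×-dec_)

-- Sums over vertices and their change at one or two points.

∑ : ∀ {n} → (Fin n → ℕ) → ℕ
∑ {n} f = sum (map f (allFin n))

∑-suc : ∀ {n} (f : Fin (suc n) → ℕ) → ∑ f ≡ f zero + ∑ (f ∘ suc)
∑-suc f = cong (f zero +_) (cong sum (trans (map-tabulate suc f) (sym (map-tabulate id (f ∘ suc)))))

∑-cong : ∀ {n} {f g : Fin n → ℕ} → f ≗ g → ∑ f ≡ ∑ g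
∑-cong {f = f} {g} f≗g = cong sum (trans (map-tabulate id f)
  (trans (tabulate-cong f≗g) (sym (map-tabulate id g))))

∑-const : ∀ n k → ∑ {n} (λ _ → k) ≡ n * k
∑-const zero    k = refl
∑-const (suc n) k = trans (∑-suc {n} (λ _ → k)) (cong (k +_) (∑-const n k))

∑-distrib-+ : ∀ {n} (f g : Fin n → ℕ) → ∑ (λ v → f v + g v) ≡ ∑ f + ∑ g
∑-distrib-+ {zero}  f g = refl
∑-distrib-+ {suc n} f g
  rewrite ∑-suc (λ v → f v + g v) | ∑-suc f | ∑-suc g
        | ∑-distrib-+ (f ∘ suc) (g ∘ suc) =
  interchange (f zero) (g zero) (∑ (f ∘ suc)) (∑ (g ∘ suc))
  where
  interchange : ∀ a b c d → a + b + (c + d) ≡ a + c + (b + d)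
  interchange = solve-∀

≤∑ : ∀ {n} (f : Fin n → ℕ) v → f v ≤ ∑ f
≤∑ f zero    rewrite ∑-suc f = m≤m+n (f zero) _
≤∑ f (suc v) rewrite ∑-suc f = ≤-trans (≤∑ (f ∘ suc) v) (m≤n+m _ (f zero))

-- Old and new values stand on opposite sides, so no truncated subtraction occurs. All later changes
-- of degrees and of the potential are derived from this form.
∑-update : ∀ {n} {f g : Fin n → ℕ} k → (∀ v → v ≢ k → g v ≡ f v) → ∑ g + f k ≡ ∑ f + g k
∑-update {f = f} {g} zero g≡f
  rewrite ∑-suc f | ∑-suc g | ∑-cong (λ v → g≡f (suc v) λ ()) =
  swap (f zero) (g zero) (∑ (f ∘ suc))
  where
  swap : ∀ a b c → b + c + a ≡ a + c + b
  swap = solve-∀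
∑-update {f = f} {g} (suc k) g≡f
  rewrite ∑-suc f | ∑-suc g | g≡f zero (λ ()) =
  trans (+-assoc (f zero) _ _)
    (trans (cong (f zero +_) (∑-update k λ v v≢k → g≡f (suc v) λ { refl → v≢k refl }))
      (sym (+-assoc (f zero) _ _)))

-- Two single updates through the intermediate `h`, which agrees with `g` at `i` and with `f`
-- elsewhere; `i ≢ j` keeps `h j` equal to `f j`.
∑-update₂ : ∀ {n} {f g : Fin n → ℕ} {i j} → i ≢ j →
  (∀ v → v ≢ i → v ≢ j → g v ≡ f v) → ∑ g + (f i + f j) ≡ ∑ f + (g i + g j)
∑-update₂ {f = f} {g} {i} {j} i≢j g≡f = combine (∑ f) (∑ h) (∑ g) (f i) (f j) (g i) (g j)
  (subst (λ x → ∑ h + f i ≡ ∑ f + x) hi (∑-update i h≡f))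
  (subst (λ x → ∑ g + x ≡ ∑ h + g j) hj (∑-update j g≡h))
  where
  h : Fin _ → ℕ
  h v = if ⌊ v ≟ i ⌋ then g v else f v
  hi : h i ≡ g i
  hi with i ≟ i
  ... | yes _  = refl
  ... | no i≢i = contradiction refl i≢i
  hj : h j ≡ f j
  hj with j ≟ i
  ... | yes refl = contradiction refl i≢j
  ... | no _     = refl
  h≡f : ∀ v → v ≢ i → h v ≡ f v
  h≡f v v≢i with v ≟ i
  ... | yes v≡i = contradiction v≡i v≢i
  ... | no _    = refl
  g≡h : ∀ v → v ≢ j → g v ≡ h v
  g≡h v v≢j with v ≟ i
  ... | yes _  = refl
  ... | no v≢i = g≡f v v≢i v≢j
  combine : ∀ F H G a b c d → H + a ≡ F + c → G + b ≡ H + d → G + (a + b) ≡ F + (c + d)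
  combine F H G a b c d p q = begin
    G + (a + b)  ≡⟨ r₁ G a b ⟩
    (G + b) + a  ≡⟨ cong (_+ a) q ⟩
    (H + d) + a  ≡⟨ r₂ H d a ⟩
    (H + a) + d  ≡⟨ cong (_+ d) p ⟩
    (F + c) + d  ≡⟨ +-assoc F c d ⟩
    F + (c + d)  ∎
    where
    open ≡-Reasoning
    r₁ : ∀ G a b → G + (a + b) ≡ (G + b) + a
    r₁ = solve-∀
    r₂ : ∀ H d a → (H + d) + a ≡ (H + a) + d
    r₂ = solve-∀

-- Degrees and the effect of colouring one edge.

𝟙 : Bool → ℕ
𝟙 b = if b then 1 else 0

-- deg c x v unfolds to ∑ (incidence c x v).
incidence : ∀ {n} → Colouring n → Colour → Fin n → Fin n → ℕ
incidence c x v u = if ⌊ u ≟ v ⌋ then 0 else 𝟙 (edgeCol c u v ==ᶜ x)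

incidence-≢ : ∀ {n} (c : Colouring n) x {v u} → u ≢ v → incidence c x v u ≡ 𝟙 (edgeCol c u v ==ᶜ x)
incidence-≢ c x {v} {u} u≢v with u ≟ v
... | yes u≡v = contradiction u≡v u≢v
... | no _    = refl

edgeCol-< : ∀ {n} (c : Colouring n) {i j} → i <ᶠ j → edgeCol c i j ≡ c i j
edgeCol-< c {i} {j} i<j with i <ᶠ? j
... | yes _  = refl
... | no i≮j = contradiction i<j i≮j

edgeCol-> : ∀ {n} (c : Colouring n) {i j} → i <ᶠ j → edgeCol c j i ≡ c i j
edgeCol-> c {i} {j} i<j with j <ᶠ? i
... | yes j<i = contradiction j<i (<-asym i<j)
... | no _    = refl

paint-at : ∀ {n} (c : Colouring n) i j x → paint c i j x i j ≡ x
paint-at c i j x with i ≟ i | j ≟ j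
... | yes _ | yes _  = refl
... | no i≢i | _     = contradiction refl i≢i
... | yes _ | no j≢j = contradiction refl j≢j

paint-elsewhere : ∀ {n} (c : Colouring n) i j x {a b} → ¬ (a ≡ i × b ≡ j) → paint c i j x a b ≡ c a b
paint-elsewhere c i j x {a} {b} ne with a ≟ i | b ≟ j
... | yes p | yes q = contradiction (p , q) ne
... | yes _ | no _  = refl
... | no _  | _     = refl

-- Both orders must be excluded because `edgeCol` may look up the pair swapped.
edgeCol-elsewhere : ∀ {n} (c : Colouring n) i j x {a b} →
  ¬ (a ≡ i × b ≡ j) → ¬ (a ≡ j × b ≡ i) → edgeCol (paint c i j x) a b ≡ edgeCol c a b
edgeCol-elsewhere c i j x {a} {b} ne₁ ne₂ with a <ᶠ? b
... | yes _ = paint-elsewhere c i j x ne₁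
... | no _  = paint-elsewhere c i j x λ { (p , q) → ne₂ (q , p) }

incidence-elsewhere : ∀ {n} (c : Colouring n) i j x y v u →
  ¬ (u ≡ i × v ≡ j) → ¬ (u ≡ j × v ≡ i) → incidence (paint c i j x) y v u ≡ incidence c y v u
incidence-elsewhere c i j x y v u ne₁ ne₂ =
  cong (λ z → if ⌊ u ≟ v ⌋ then 0 else 𝟙 (z ==ᶜ y)) (edgeCol-elsewhere c i j x ne₁ ne₂)

deg-elsewhere : ∀ {n} (c : Colouring n) i j x y {v} → v ≢ i → v ≢ j →
  deg (paint c i j x) y v ≡ deg c y v
deg-elsewhere c i j x y {v} v≢i v≢j = ∑-cong λ u →
  incidence-elsewhere c i j x y v u (λ { (_ , q) → v≢j q }) (λ { (_ , q) → v≢i q })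

module _ {n} (c : Colouring n) {i j : Fin n} (i<j : i <ᶠ j) (x y : Colour) where

  private
    i≢j : i ≢ j
    i≢j = <⇒≢ i<j

  -- Among the summands of the degree at `i` only the one at `j` changes, from the indicator of the
  -- old colour to that of `x`.
  deg-paintˡ : deg (paint c i j x) y i + 𝟙 (c i j ==ᶜ y) ≡ deg c y i + 𝟙 (x ==ᶜ y)
  deg-paintˡ = begin
    deg c′ y i + 𝟙 (c i j ==ᶜ y)      ≡⟨ cong (deg c′ y i +_) (sym (at-j c refl)) ⟩
    deg c′ y i + incidence c y i j    ≡⟨ ∑-update j off ⟩
    deg c y i + incidence c′ y i j    ≡⟨ cong (deg c y i +_) (at-j c′ (paint-at c i j x)) ⟩
    deg c y i + 𝟙 (x ==ᶜ y)           ∎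
    where
    open ≡-Reasoning
    c′ : Colouring n
    c′ = paint c i j x
    at-j : ∀ (d : Colouring n) {z} → d i j ≡ z → incidence d y i j ≡ 𝟙 (z ==ᶜ y)
    at-j d refl = trans (incidence-≢ d y (λ e → i≢j (sym e)))
                        (cong (λ z → 𝟙 (z ==ᶜ y)) (edgeCol-> d i<j))
    off : ∀ u → u ≢ j → incidence c′ y i u ≡ incidence c y i u
    off u u≢j = incidence-elsewhere c i j x y i u (λ { (_ , q) → i≢j q }) (λ { (p , _) → u≢j p })

  deg-paintʳ : deg (paint c i j x) y j + 𝟙 (c i j ==ᶜ y) ≡ deg c y j + 𝟙 (x ==ᶜ y)
  deg-paintʳ = begin
    deg c′ y j + 𝟙 (c i j ==ᶜ y)      ≡⟨ cong (deg c′ y j +_) (sym (at-i c refl)) ⟩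
    deg c′ y j + incidence c y j i    ≡⟨ ∑-update i off ⟩
    deg c y j + incidence c′ y j i    ≡⟨ cong (deg c y j +_) (at-i c′ (paint-at c i j x)) ⟩
    deg c y j + 𝟙 (x ==ᶜ y)           ∎
    where
    open ≡-Reasoning
    c′ : Colouring n
    c′ = paint c i j x
    at-i : ∀ (d : Colouring n) {z} → d i j ≡ z → incidence d y j i ≡ 𝟙 (z ==ᶜ y)
    at-i d refl = trans (incidence-≢ d y i≢j) (cong (λ z → 𝟙 (z ==ᶜ y)) (edgeCol-< d i<j))
    off : ∀ u → u ≢ i → incidence c′ y j u ≡ incidence c y j u
    off u u≢i = incidence-elsewhere c i j x y j u (λ { (p , _) → u≢i p }) (λ { (_ , q) → i≢j (sym q) })

deg-blank : ∀ {n} x → none ≢ x → (v : Fin n) → deg blank x v ≡ 0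
deg-blank {n} x none≢x v = trans (∑-cong zeros) (trans (∑-const n 0) (n*0≡0 n))
  where
  n*0≡0 : ∀ n → n * 0 ≡ 0
  n*0≡0 = solve-∀
  ==-false : ∀ x → none ≢ x → (none ==ᶜ x) ≡ false
  ==-false none p = contradiction refl p
  ==-false red  _ = refl
  ==-false blue _ = refl
  edgeCol-blank : ∀ (u v : Fin n) → edgeCol blank u v ≡ none
  edgeCol-blank u v with u <ᶠ? v
  ... | yes _ = refl
  ... | no _  = refl
  zeros : ∀ u → incidence blank x v u ≡ 0
  zeros u with u ≟ v
  ... | yes _ = refl
  ... | no _ rewrite edgeCol-blank u v | ==-false x none≢x = refl

-- The three incidences add up to 1 at every vertex except `v`, where they add up to 0. Comparison
-- with the constant 1 on `suc n` vertices leaves `n`.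
deg-sum : ∀ {n} (c : Colouring (suc n)) v → deg c red v + deg c blue v + deg c none v ≡ n
deg-sum {n} c v = begin
  deg c red v + deg c blue v + deg c none v
    ≡⟨ cong (_+ deg c none v) (∑-distrib-+ (incidence c red v) (incidence c blue v)) ⟨
  ∑ (λ u → incidence c red v u + incidence c blue v u) + deg c none v
    ≡⟨ ∑-distrib-+ _ (incidence c none v) ⟨
  ∑ total
    ≡⟨ +-cancelʳ-≡ 1 (∑ total) n (begin
         ∑ total + 1              ≡⟨ ∑-update {f = λ _ → 1} {total} v total-off ⟩
         ∑ {suc n} (λ _ → 1) + total v  ≡⟨ cong₂ _+_ (∑-const (suc n) 1) total-at ⟩
         suc n * 1 + 0            ≡⟨ r n ⟩
         n + 1                    ∎) ⟩
  n ∎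
  where
  open ≡-Reasoning
  total : Fin (suc n) → ℕ
  total u = incidence c red v u + incidence c blue v u + incidence c none v u
  one-colour : ∀ z → 𝟙 (z ==ᶜ red) + 𝟙 (z ==ᶜ blue) + 𝟙 (z ==ᶜ none) ≡ 1
  one-colour none = refl
  one-colour red  = refl
  one-colour blue = refl
  total-off : ∀ u → u ≢ v → total u ≡ 1
  total-off u u≢v with u ≟ v
  ... | yes u≡v = contradiction u≡v u≢v
  ... | no _    = one-colour (edgeCol c u v)
  total-at : total v ≡ 0
  total-at with v ≟ v
  ... | yes _  = refl
  ... | no v≢v = contradiction refl v≢v
  r : ∀ n → suc n * 1 + 0 ≡ n + 1
  r = solve-∀

-- Exponential growth against polynomial factors.

bernoulli : ∀ C k → C ^ k * (C + k) ≤ C * suc C ^ k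
bernoulli C zero    = ≤-reflexive (r C)
  where
  r : ∀ C → 1 * (C + 0) ≡ C * 1
  r = solve-∀
bernoulli C (suc k) = begin
  C * C ^ k * (C + suc k)                    ≤⟨ m≤m+n _ _ ⟩
  C * C ^ k * (C + suc k) + C ^ k * k        ≡⟨ r C (C ^ k) k ⟩
  suc C * (C ^ k * (C + k))                  ≤⟨ *-monoʳ-≤ (suc C) (bernoulli C k) ⟩
  suc C * (C * suc C ^ k)                    ≡⟨ r′ C (suc C ^ k) ⟩
  C * (suc C * suc C ^ k)                    ∎
  where
  open ≤-Reasoning
  r : ∀ C P k → C * P * (C + suc k) + P * k ≡ suc C * (P * (C + k))
  r = solve-∀
  r′ : ∀ C P → suc C * (C * P) ≡ C * (suc C * P)
  r′ = solve-∀

-- Cubing Bernoulli's inequality makes (1 + 1/C)^d grow cubically in d.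
exponential-growth : ∀ C .{{_ : NonZero C}} →
  ∃ λ N → ∀ d → N ≤ d → (d + 3) * (d + 3) * C ^ d < suc C ^ d
exponential-growth C = K * 3 , λ d K3≤d →
  subst (λ d → (d + 3) * (d + 3) * C ^ d < suc C ^ d) (sym (m≡m%n+[m/n]*n d 3))
    (bound (d % 3) (d / 3) (m<1+n⇒m≤n (m%n<n d 3))
      (≤-trans (≤-reflexive (sym (m*n/n≡m K 3))) (/-monoˡ-≤ 3 K3≤d)))
  where
  K : ℕ
  -- With `k` the quotient of `d` by 3, `d + 3 ≤ 8 * k`, so the square costs `64 * k * k`. The cubed
  -- inequality supplies `k * k * k` at the price of `C * C * C`, hence `k > 64 * (C * C * C)`
  -- suffices.
  K = suc (64 * (C * C * C))
  cube : ∀ x y → x * (y * y * y) ≡ x * y * y * y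
  cube = solve-∀
  bound : ∀ r k → r ≤ 2 → K ≤ k →
    (r + k * 3 + 3) * (r + k * 3 + 3) * C ^ (r + k * 3) < suc C ^ (r + k * 3)
  bound r k@(suc k-1) r≤2 K≤k = *-cancelˡ-< (C * C * C) _ _ (begin-strict
    C * C * C * (e * e * C ^ (r + k * 3))
      ≡⟨ cong (λ z → C * C * C * (e * e * z)) (power C) ⟩
    C * C * C * (e * e * (C ^ r * (P * P * P)))
      ≤⟨ *-monoʳ-≤ (C * C * C) (*-monoˡ-≤ _ (*-mono-≤ e≤8k e≤8k)) ⟩
    C * C * C * (8 * k * (8 * k) * (C ^ r * (P * P * P)))
      ≡⟨ r₁ C k (C ^ r) P ⟩
    64 * (C * C * C) * (k * k * (C ^ r * (P * P * P)))
      <⟨ *-monoˡ-< (k * k * (C ^ r * (P * P * P))) {{nz}} K≤k ⟩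
    k * (k * k * (C ^ r * (P * P * P)))
      ≡⟨ r₂ k (C ^ r) P ⟩
    C ^ r * (P * k * (P * k) * (P * k))
      ≤⟨ *-mono-≤ (^-monoˡ-≤ r (n≤1+n C)) (*-mono-≤ (*-mono-≤ step step) step) ⟩
    suc C ^ r * (C * Q * (C * Q) * (C * Q))
      ≡⟨ r₃ C (suc C ^ r) Q ⟩
    C * C * C * (suc C ^ r * (Q * Q * Q))
      ≡⟨ cong (C * C * C *_) (power (suc C)) ⟨
    C * C * C * suc C ^ (r + k * 3) ∎)
    where
    open ≤-Reasoning
    P Q e : ℕ
    P = C ^ k
    Q = suc C ^ k
    e = r + k * 3 + 3
    nz : NonZero (k * k * (C ^ r * (P * P * P)))
    nz = m*n≢0 (k * k) (C ^ r * (P * P * P))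
           {{m*n≢0 k k}}
           {{m*n≢0 (C ^ r) (P * P * P) {{m^n≢0 C r}}
             {{m*n≢0 (P * P) P {{m*n≢0 P P {{m^n≢0 C k}} {{m^n≢0 C k}}}} {{m^n≢0 C k}}}}}}
    step : P * k ≤ C * Q
    step = ≤-trans (*-monoʳ-≤ P (m≤n+m k C)) (bernoulli C k)
    e≤8k : e ≤ 8 * k
    e≤8k = begin
      r + k * 3 + 3             ≤⟨ +-monoˡ-≤ 3 (+-monoˡ-≤ (k * 3) r≤2) ⟩
      2 + k * 3 + 3             ≤⟨ m≤m+n _ (k-1 * 5) ⟩
      2 + k * 3 + 3 + k-1 * 5   ≡⟨ r₀ k-1 ⟩
      8 * k                     ∎
      where
      r₀ : ∀ k-1 → 2 + suc k-1 * 3 + 3 + k-1 * 5 ≡ 8 * suc k-1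
      r₀ = solve-∀
    power : ∀ D → D ^ (r + k * 3) ≡ D ^ r * (D ^ k * D ^ k * D ^ k)
    power D = trans (^-distribˡ-+-* D r (k * 3))
      (cong (D ^ r *_) (trans (sym (^-*-assoc D k 3)) (r₄ (D ^ k))))
      where
      r₄ : ∀ x → x * (x * (x * 1)) ≡ x * x * x
      r₄ = solve-∀
    r₁ : ∀ C k R P → C * C * C * (8 * k * (8 * k) * (R * (P * P * P)))
                   ≡ 64 * (C * C * C) * (k * k * (R * (P * P * P)))
    r₁ = solve-∀
    r₂ : ∀ k R P → k * (k * k * (R * (P * P * P))) ≡ R * (P * k * (P * k) * (P * k))
    r₂ = solve-∀
    r₃ : ∀ C R Q → R * (C * Q * (C * Q) * (C * Q)) ≡ C * C * C * (R * (Q * Q * Q))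
    r₃ = solve-∀

[a*b]^k≡a^k*b^k : ∀ a b k → (a * b) ^ k ≡ a ^ k * b ^ k
[a*b]^k≡a^k*b^k a b zero    = refl
[a*b]^k≡a^k*b^k a b (suc k) = trans (cong (a * b *_) ([a*b]^k≡a^k*b^k a b k)) (r a b (a ^ k) (b ^ k))
  where
  r : ∀ a b x y → a * b * (x * y) ≡ a * x * (b * y)
  r = solve-∀

-- With `r = s + t` the two sides differ only by a factor `b ^ t` on the left in place of `a ^ t` on
-- the right.
[ab]^[r+s]≤[a^r*b^s]² : ∀ {a b r s} → b ≤ a → s ≤ r →
  (a * b) ^ (r + s) ≤ (a ^ r * b ^ s) * (a ^ r * b ^ s)
[ab]^[r+s]≤[a^r*b^s]² {a} {b} {r} {s} b≤a s≤r with m≤n⇒∃[o]m+o≡n s≤r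
... | t , refl = begin
  (a * b) ^ (s + t + s)
    ≡⟨ [a*b]^k≡a^k*b^k a b (s + t + s) ⟩
  a ^ (s + t + s) * b ^ (s + t + s)
    ≡⟨ cong₂ _*_ (split a) (split b) ⟩
  a ^ s * a ^ t * a ^ s * (b ^ s * b ^ t * b ^ s)
    ≤⟨ *-monoʳ-≤ (a ^ s * a ^ t * a ^ s) (*-monoˡ-≤ (b ^ s) (*-monoʳ-≤ (b ^ s) (^-monoˡ-≤ t b≤a))) ⟩
  a ^ s * a ^ t * a ^ s * (b ^ s * a ^ t * b ^ s)
    ≡⟨ r₁ (a ^ s) (a ^ t) (b ^ s) ⟩
  a ^ s * a ^ t * b ^ s * (a ^ s * a ^ t * b ^ s)
    ≡⟨ cong (λ z → z * b ^ s * (z * b ^ s)) (^-distribˡ-+-* a s t) ⟨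
  a ^ (s + t) * b ^ s * (a ^ (s + t) * b ^ s) ∎
  where
  open ≤-Reasoning
  split : ∀ x → x ^ (s + t + s) ≡ x ^ s * x ^ t * x ^ s
  split x = trans (^-distribˡ-+-* x (s + t) s) (cong (_* x ^ s) (^-distribˡ-+-* x s t))
  r₁ : ∀ x y z → x * y * x * (z * y * z) ≡ x * y * z * (x * y * z)
  r₁ = solve-∀

-- Budgets for single moves and for the change of turn.

-- An edge of weight s raises the potential by s/m when Alice takes it.  With
-- suc k edges left in her turn, the potential plus suc k / l times any free edge
-- stays below Φ₀, where l + suc k = m; this ratio is what makes the bound
-- reproduce itself although her edge also raises the weights of its neighbours.
module _ {l k m Φ Φ′ Φ₀ s : ℕ} (l+k≡m : l + suc k ≡ m) (m*Φ′≡ : m * Φ′ ≡ m * Φ + s) where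

  private
    open ≤-Reasoning

    suc-budget : ∀ {t} → Φ ≤ Φ₀ → l * Φ + suc k * t ≤ l * Φ₀ → suc l * Φ + suc k * t ≤ suc l * Φ₀
    suc-budget {t} Φ≤Φ₀ h = begin
      suc l * Φ + suc k * t     ≡⟨ +-assoc Φ (l * Φ) (suc k * t) ⟩
      Φ + (l * Φ + suc k * t)   ≤⟨ +-mono-≤ Φ≤Φ₀ h ⟩
      suc l * Φ₀                ∎

  red-potential-≤ : .{{_ : NonZero m}} → Φ ≤ Φ₀ → l * Φ + suc k * s ≤ l * Φ₀ → Φ′ ≤ Φ₀
  red-potential-≤ Φ≤Φ₀ h = *-cancelˡ-≤ m (begin
    m * Φ′                                ≡⟨ m*Φ′≡ ⟩
    m * Φ + s                             ≤⟨ m≤m+n _ (k * s) ⟩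
    m * Φ + s + k * s                     ≡⟨ cong (λ m → m * Φ + s + k * s) l+k≡m ⟨
    (l + suc k) * Φ + s + k * s           ≡⟨ r₁ l k Φ s ⟩
    suc k * Φ + (l * Φ + suc k * s)       ≤⟨ +-mono-≤ (*-monoʳ-≤ (suc k) Φ≤Φ₀) h ⟩
    suc k * Φ₀ + l * Φ₀                   ≡⟨ r₂ l k Φ₀ ⟩
    (l + suc k) * Φ₀                      ≡⟨ cong (_* Φ₀) l+k≡m ⟩
    m * Φ₀                                ∎)
    where
    r₁ : ∀ l k Φ s → (l + suc k) * Φ + s + k * s ≡ suc k * Φ + (l * Φ + suc k * s)
    r₁ = solve-∀
    r₂ : ∀ l k Φ → suc k * Φ + l * Φ ≡ (l + suc k) * Φ
    r₂ = solve-∀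

  -- The left side increases in both `s` and `t`, and they may come in either order, so both are
  -- replaced by the larger one, `u`. It then equals exactly `m` times the old budget with `l`
  -- raised by one, which `suc-budget` bounds.
  red-budget : .{{_ : NonZero m}} → ∀ {t t′} → m * t′ ≤ suc m * t → Φ ≤ Φ₀ →
    l * Φ + suc k * s ≤ l * Φ₀ → l * Φ + suc k * t ≤ l * Φ₀ →
    suc l * Φ′ + k * t′ ≤ suc l * Φ₀
  red-budget {t} {t′} t′≤ Φ≤Φ₀ hs ht = *-cancelˡ-≤ m (begin
    m * (suc l * Φ′ + k * t′)                             ≡⟨ r₁ m l k Φ′ t′ ⟩
    suc l * (m * Φ′) + k * (m * t′)                       ≤⟨ +-mono-≤ (≤-reflexive (cong (suc l *_) m*Φ′≡)) (*-monoʳ-≤ k t′≤) ⟩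
    suc l * (m * Φ + s) + k * (suc m * t)                 ≡⟨ cong (λ m → suc l * (m * Φ + s) + k * (suc m * t)) l+k≡m ⟨
    suc l * ((l + suc k) * Φ + s) + k * (suc (l + suc k) * t) ≡⟨ r₂ l k Φ s t ⟩
    suc l * (suc l * Φ + s) + (suc l * (k * Φ) + k * (l + k + 2) * t)
      ≤⟨ both (≤-total s t) ⟩
    m * (suc l * Φ₀)                                      ∎)
    where
    r₁ : ∀ m l k Φ t → m * (suc l * Φ + k * t) ≡ suc l * (m * Φ) + k * (m * t)
    r₁ = solve-∀
    r₂ : ∀ l k Φ s t → suc l * ((l + suc k) * Φ + s) + k * (suc (l + suc k) * t)
       ≡ suc l * (suc l * Φ + s) + (suc l * (k * Φ) + k * (l + k + 2) * t)
    r₂ = solve-∀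
    r₃ : ∀ l k Φ t → suc l * (suc l * Φ + t) + (suc l * (k * Φ) + k * (l + k + 2) * t)
       ≡ (l + suc k) * (suc l * Φ + suc k * t)
    r₃ = solve-∀
    max-case : ∀ u → s ≤ u → t ≤ u → l * Φ + suc k * u ≤ l * Φ₀ →
      suc l * (suc l * Φ + s) + (suc l * (k * Φ) + k * (l + k + 2) * t) ≤ m * (suc l * Φ₀)
    max-case u s≤u t≤u hu = begin
      suc l * (suc l * Φ + s) + (suc l * (k * Φ) + k * (l + k + 2) * t)
        ≤⟨ +-mono-≤ (*-monoʳ-≤ (suc l) (+-monoʳ-≤ (suc l * Φ) s≤u))
                    (+-monoʳ-≤ (suc l * (k * Φ)) (*-monoʳ-≤ (k * (l + k + 2)) t≤u)) ⟩
      suc l * (suc l * Φ + u) + (suc l * (k * Φ) + k * (l + k + 2) * u)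
        ≡⟨ r₃ l k Φ u ⟩
      (l + suc k) * (suc l * Φ + suc k * u)
        ≤⟨ *-monoʳ-≤ (l + suc k) (suc-budget Φ≤Φ₀ hu) ⟩
      (l + suc k) * (suc l * Φ₀)
        ≡⟨ cong (_* (suc l * Φ₀)) l+k≡m ⟩
      m * (suc l * Φ₀) ∎
    both : s ≤ t ⊎ t ≤ s → _
    both (inj₁ s≤t) = max-case t s≤t ≤-refl ht
    both (inj₂ t≤s) = max-case s ≤-refl t≤s hs

-- The greedy choice gives `t ≤ s`, so the drop `s` pays for one further copy of `t′`; the `i`
-- earlier copies remain paid for because weights do not rise.
blue-budget : ∀ {D i Φ Φ′ Φ₀ s t t′} → D * Φ′ + s ≡ D * Φ → t ≤ s → t′ ≤ t →
  D * Φ + i * t ≤ D * Φ₀ → D * Φ′ + suc i * t′ ≤ D * Φ₀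
blue-budget {D} {i} {Φ} {Φ′} {Φ₀} {s} {t} {t′} eq t≤s t′≤t h = begin
  D * Φ′ + suc i * t′        ≤⟨ +-monoʳ-≤ (D * Φ′) (+-mono-≤ (≤-trans t′≤t t≤s) (*-monoʳ-≤ i t′≤t)) ⟩
  D * Φ′ + (s + i * t)       ≡⟨ +-assoc (D * Φ′) s (i * t) ⟨
  D * Φ′ + s + i * t         ≡⟨ cong (_+ i * t) eq ⟩
  D * Φ + i * t              ≤⟨ h ⟩
  D * Φ₀                     ∎
  where open ≤-Reasoning

-- As `p / l ≤ q / D`, the room of `q * t / D` that Bob has made below `Φ₀` covers the `p * t / l`
-- required when Alice starts her turn.
exchange-budget : ∀ {D l p q Φ Φ₀ t} .{{_ : NonZero D}} → D * p ≤ l * q →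
  D * Φ + q * t ≤ D * Φ₀ → l * Φ + p * t ≤ l * Φ₀
exchange-budget {D} {l} {p} {q} {Φ} {Φ₀} {t} Dp≤lq h = *-cancelˡ-≤ D (begin
  D * (l * Φ + p * t)       ≡⟨ r₁ D l p Φ t ⟩
  l * (D * Φ) + D * p * t   ≤⟨ +-monoʳ-≤ (l * (D * Φ)) (*-monoˡ-≤ t Dp≤lq) ⟩
  l * (D * Φ) + l * q * t   ≡⟨ r₂ D l q Φ t ⟩
  l * (D * Φ + q * t)       ≤⟨ *-monoʳ-≤ l h ⟩
  l * (D * Φ₀)              ≡⟨ r₃ D l Φ₀ ⟩
  D * (l * Φ₀)              ∎)
  where
  open ≤-Reasoning
  r₁ : ∀ D l p Φ t → D * (l * Φ + p * t) ≡ l * (D * Φ) + D * p * t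
  r₁ = solve-∀
  r₂ : ∀ D l q Φ t → l * (D * Φ) + l * q * t ≡ l * (D * Φ + q * t)
  r₂ = solve-∀
  r₃ : ∀ D l Φ → l * (D * Φ) ≡ D * (l * Φ)
  r₃ = solve-∀

-- Free edges and a heaviest one among them.

none? : ∀ x → Dec (x ≡ none)
none? none = yes refl
none? red  = no λ ()
none? blue = no λ ()

module _ {n} (c : Colouring n) where

  Free : Fin n × Fin n → Set
  Free (i , j) = i <ᶠ j × c i j ≡ none

  free? : ∀ e → Dec (Free e)
  free? (i , j) = (i <ᶠ? j) ×-dec none? (c i j)

  full-or-heaviest : (f : Fin n × Fin n → ℕ) →
    Full c ⊎ ∃ λ e → Free e × (∀ e′ → Free e′ → f e′ ≤ f e)
  full-or-heaviest f = search (filter free? edges) (λ {e} → ∈-filter⁺ free? (∈-edges e)) (all-filter free? edges)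
    where
    edges : List (Fin n × Fin n)
    edges = cartesianProduct (allFin n) (allFin n)
    ∈-edges : ∀ e → e ∈ edges
    ∈-edges (i , j) = ∈-cartesianProduct⁺ (∈-allFin i) (∈-allFin j)
    -- The list is abstracted together with its completeness and soundness, so that an empty list
    -- means a full colouring and a nonempty one gives `argmax` a free default.
    search : ∀ es → (∀ {e} → Free e → e ∈ es) → All Free es →
      Full c ⊎ ∃ λ e → Free e × (∀ e′ → Free e′ → f e′ ≤ f e)
    search []       ∈free _ = inj₁ λ i j i<j cij≡none → contradiction (∈free {i , j} (i<j , cij≡none)) λ ()
    search (e ∷ es) ∈free all@(p ∷ _) = inj₂
      ( argmax f e (e ∷ es)
      , argmax-all f p all
      , λ e′ free → All.lookup (f[xs]≤f[argmax] {f = f} e (e ∷ es)) (∈free free))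

-- Full colourings, blue majorities and the termination measure.

Full⇒deg-none≡0 : ∀ {n} {c : Colouring n} → Full c → ∀ v → deg c none v ≡ 0
Full⇒deg-none≡0 {n} {c} full v = trans (∑-cong zeros) (trans (∑-const n 0) (*-zeroʳ n))
  where
  coloured : ∀ {u v} → u ≢ v → edgeCol c u v ≢ none
  coloured {u} {v} u≢v eq with <-cmp u v
  ... | tri< u<v _ _ = full u v u<v (trans (sym (edgeCol-< c u<v)) eq)
  ... | tri≈ _ u≡v _ = u≢v u≡v
  ... | tri> _ _ v<u = full v u v<u (trans (sym (edgeCol-> c v<u)) eq)
  not-none : ∀ {x} → x ≢ none → 𝟙 (x ==ᶜ none) ≡ 0
  not-none {none} p = contradiction refl p
  not-none {red}  _ = refl
  not-none {blue} _ = refl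
  zeros : ∀ u → incidence c none v u ≡ 0
  zeros u with u ≟ v
  ... | yes _  = refl
  ... | no u≢v = not-none (coloured u≢v)

BlueMajority : ∀ {n} → Colouring n → Set
BlueMajority c = ∀ v → deg c red v < deg c blue v

BlueMajority⇒StarBobWin : ∀ {n} (c : Colouring (suc n)) → BlueMajority c → StarBobWin c
BlueMajority⇒StarBobWin c bm =
  -- The vertex `zero` makes the blue maximum positive, as the default 0 of the fold requires.
  max< (allFin _) (≤-<-trans z≤n (red<Δ zero)) red<Δ
  where
  ≤max : ∀ {x xs} → x ∈ xs → x ≤ foldr _⊔_ 0 xs
  ≤max (here refl)    = m≤m⊔n _ _
  ≤max (there {x} x∈) = ≤-trans (≤max x∈) (m≤n⊔m x _)
  deg≤Δ : ∀ v → deg c blue v ≤ Δ c blue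
  deg≤Δ v = ≤max (∈-map⁺ (deg c blue) (∈-allFin v))
  red<Δ : ∀ v → deg c red v < Δ c blue
  red<Δ v = <-≤-trans (bm v) (deg≤Δ v)
  max< : ∀ {M} vs → 0 < M → (∀ v → deg c red v < M) → foldr _⊔_ 0 (map (deg c red) vs) < M
  max< []       0<M _ = 0<M
  max< (v ∷ vs) 0<M h = ⊔-lub (h v) (max< vs 0<M h)

BlueMajority⇒CaptureBobWin : ∀ {n} (c : Colouring (suc n)) → BlueMajority c → CaptureBobWin c
BlueMajority⇒CaptureBobWin {n} c bm = subst₂ _<_
  (sym (trans (∑-cong none-red) (trans (∑-const (suc n) 0) (*-zeroʳ n))))
  (sym (trans (∑-cong all-blue) (∑-const (suc n) 1)))
  (s≤s z≤n)
  where
  none-red : ∀ v → 𝟙 ⌊ deg c blue v <? deg c red v ⌋ ≡ 0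
  none-red v with deg c blue v <? deg c red v
  ... | yes b<r = contradiction b<r (<⇒≯ (bm v))
  ... | no _    = refl
  all-blue : ∀ v → 𝟙 ⌊ deg c red v <? deg c blue v ⌋ ≡ 1
  all-blue v with deg c red v <? deg c blue v
  ... | yes _  = refl
  ... | no r≮b = contradiction (bm v) r≮b

-- The free degree drops by one at each end. This sum is the measure that makes the recursion of the
-- strategy terminate.
∑-deg-none-decreases : ∀ {n} (c : Colouring n) {i j x} → Free c (i , j) → x ≢ none →
  ∑ (deg (paint c i j x) none) < ∑ (deg c none)
∑-deg-none-decreases c {i} {j} {x} (i<j , cij) x≢none = drop
  (∑-update₂ (<⇒≢ i<j) λ v → deg-elsewhere c i j x none)
  (at x≢none cij (deg-paintˡ c i<j x none)) (at x≢none cij (deg-paintʳ c i<j x none))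
  where
  at : ∀ {x y d d′} → x ≢ none → y ≡ none → d′ + 𝟙 (y ==ᶜ none) ≡ d + 𝟙 (x ==ᶜ none) → d ≡ suc d′
  at {none}         x≢ _    _  = contradiction refl x≢
  at {red}  {d = d} {d′} _ refl eq = sym (trans (+-comm 1 d′) (trans eq (+-identityʳ d)))
  at {blue} {d = d} {d′} _ refl eq = sym (trans (+-comm 1 d′) (trans eq (+-identityʳ d)))
  drop : ∀ {S S′ a b a′ b′} → S′ + (a + b) ≡ S + (a′ + b′) → a ≡ suc a′ → b ≡ suc b′ → S′ < S
  drop {S} {S′} {a′ = a′} {b′} eq refl refl = +-cancelʳ-≤ (a′ + b′) (suc S′) S (begin
    suc S′ + (a′ + b′)             ≤⟨ n≤1+n _ ⟩
    suc (suc S′ + (a′ + b′))       ≡⟨ r S′ a′ b′ ⟩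
    S′ + (suc a′ + suc b′)         ≡⟨ eq ⟩
    S + (a′ + b′)                  ∎)
    where
    open ≤-Reasoning
    r : ∀ S a b → suc (suc S + (a + b)) ≡ S + (suc a + suc b)
    r = solve-∀

-- The potential and its change under a move.

module Potential (A B C m : ℕ) (m*A≡ : m * A ≡ suc m * C) (2+m*B≡ : (2 + m) * B ≡ suc m * C) where

  -- The module hypotheses say `A / C = 1 + 1/m` and `B / C = 1 - 1/(m + 2)`: a coloured edge trades
  -- one factor `C` for `A` or `B`.
  monomial : ℕ → ℕ → ℕ → ℕ
  monomial r b u = A ^ r * B ^ b * C ^ u

  weight : ∀ {n} → Colouring n → Fin n → ℕ
  weight c v = monomial (deg c red v) (deg c blue v) (deg c none v)

  potential : ∀ {n} → Colouring n → ℕ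
  potential c = ∑ (weight c)

  edgeWeight : ∀ {n} → Colouring n → Fin n × Fin n → ℕ
  edgeWeight c (i , j) = weight c i + weight c j

  -- The hypotheses have the shape to which `deg-paintˡ` and `deg-paintʳ` reduce when an edge turns
  -- from `none` to `red`.
  monomial-red : ∀ {r b u r′ b′ u′} → r′ + 0 ≡ r + 1 → b′ + 0 ≡ b + 0 → u′ + 1 ≡ u + 0 →
    m * monomial r′ b′ u′ ≡ suc m * monomial r b u
  monomial-red {r} {b} {u} {r′} {b′} {u′} er eb eu
    rewrite trans (sym (+-identityʳ r′)) (trans er (+-comm r 1))
          | trans (sym (+-identityʳ b′)) (trans eb (+-identityʳ b))
          | trans (sym (+-identityʳ u)) (trans (sym eu) (+-comm u′ 1)) =
    trans (r₁ m A (A ^ r) (B ^ b) (C ^ u′)) (trans (cong (_* (A ^ r * B ^ b * C ^ u′)) m*A≡)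
      (r₂ m C (A ^ r) (B ^ b) (C ^ u′)))
    where
    r₁ : ∀ m A x y z → m * (A * x * y * z) ≡ m * A * (x * y * z)
    r₁ = solve-∀
    r₂ : ∀ m C x y z → suc m * C * (x * y * z) ≡ suc m * (x * y * (C * z))
    r₂ = solve-∀

  monomial-blue : ∀ {r b u r′ b′ u′} → r′ + 0 ≡ r + 0 → b′ + 0 ≡ b + 1 → u′ + 1 ≡ u + 0 →
    (2 + m) * monomial r′ b′ u′ ≡ suc m * monomial r b u
  monomial-blue {r} {b} {u} {r′} {b′} {u′} er eb eu
    rewrite trans (sym (+-identityʳ r′)) (trans er (+-identityʳ r))
          | trans (sym (+-identityʳ b′)) (trans eb (+-comm b 1))
          | trans (sym (+-identityʳ u)) (trans (sym eu) (+-comm u′ 1)) =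
    trans (r₁ m B (A ^ r) (B ^ b) (C ^ u′)) (trans (cong (_* (A ^ r * B ^ b * C ^ u′)) 2+m*B≡)
      (r₂ m C (A ^ r) (B ^ b) (C ^ u′)))
    where
    r₁ : ∀ m B x y z → (2 + m) * (x * (B * y) * z) ≡ (2 + m) * B * (x * y * z)
    r₁ = solve-∀
    r₂ : ∀ m C x y z → suc m * C * (x * y * z) ≡ suc m * (x * y * (C * z))
    r₂ = solve-∀

  module Paint {n} (c : Colouring n) {i j : Fin n} (free : Free c (i , j)) where

    private
      i<j : i <ᶠ j
      i<j = proj₁ free
      i≢j : i ≢ j
      i≢j = <⇒≢ i<j

      atˡ : ∀ x y → deg (paint c i j x) y i + 𝟙 (none ==ᶜ y) ≡ deg c y i + 𝟙 (x ==ᶜ y)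
      atˡ x y = subst (λ z → deg (paint c i j x) y i + 𝟙 (z ==ᶜ y) ≡ deg c y i + 𝟙 (x ==ᶜ y))
                  (proj₂ free) (deg-paintˡ c i<j x y)

      atʳ : ∀ x y → deg (paint c i j x) y j + 𝟙 (none ==ᶜ y) ≡ deg c y j + 𝟙 (x ==ᶜ y)
      atʳ x y = subst (λ z → deg (paint c i j x) y j + 𝟙 (z ==ᶜ y) ≡ deg c y j + 𝟙 (x ==ᶜ y))
                  (proj₂ free) (deg-paintʳ c i<j x y)

      weight-elsewhere : ∀ x v → v ≢ i → v ≢ j → weight (paint c i j x) v ≡ weight c v
      weight-elsewhere x v v≢i v≢j
        rewrite deg-elsewhere c i j x red v≢i v≢j
              | deg-elsewhere c i j x blue v≢i v≢j
              | deg-elsewhere c i j x none v≢i v≢j = refl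

      potential-update : ∀ x → potential (paint c i j x) + edgeWeight c (i , j)
        ≡ potential c + edgeWeight (paint c i j x) (i , j)
      potential-update x = ∑-update₂ i≢j (weight-elsewhere x)

      c-red c-blue : Colouring n
      c-red  = paint c i j red
      c-blue = paint c i j blue

      redˡ : m * weight c-red i ≡ suc m * weight c i
      redˡ = monomial-red {r = deg c red i} {deg c blue i} {deg c none i} (atˡ red red) (atˡ red blue) (atˡ red none)
      redʳ : m * weight c-red j ≡ suc m * weight c j
      redʳ = monomial-red {r = deg c red j} {deg c blue j} {deg c none j} (atʳ red red) (atʳ red blue) (atʳ red none)
      blueˡ : (2 + m) * weight c-blue i ≡ suc m * weight c i
      blueˡ = monomial-blue {r = deg c red i} {deg c blue i} {deg c none i} (atˡ blue red) (atˡ blue blue) (atˡ blue none)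
      blueʳ : (2 + m) * weight c-blue j ≡ suc m * weight c j
      blueʳ = monomial-blue {r = deg c red j} {deg c blue j} {deg c none j} (atʳ blue red) (atʳ blue blue) (atʳ blue none)

      scaled : ∀ k l {a b} a′ b′ → k * a′ ≡ l * a → k * b′ ≡ l * b → k * (a′ + b′) ≡ l * (a + b)
      scaled k l {a} {b} a′ b′ p q =
        trans (*-distribˡ-+ k a′ b′) (trans (cong₂ _+_ p q) (sym (*-distribˡ-+ l a b)))

    -- Each end gains `1/m` of its weight, so the potential gains `1/m` of the edge weight.
    red-potential : m * potential c-red ≡ m * potential c + edgeWeight c (i , j)
    red-potential = balance (potential c) (potential c-red) (edgeWeight c (i , j)) (edgeWeight c-red (i , j))
      (potential-update red) (scaled m (suc m) (weight c-red i) (weight c-red j) redˡ redʳ)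
      where
      balance : ∀ Φ Φ′ s s′ → Φ′ + s ≡ Φ + s′ → m * s′ ≡ suc m * s → m * Φ′ ≡ m * Φ + s
      balance Φ Φ′ s s′ p q = +-cancelʳ-≡ (m * s) (m * Φ′) (m * Φ + s) (begin
        m * Φ′ + m * s         ≡⟨ *-distribˡ-+ m Φ′ s ⟨
        m * (Φ′ + s)           ≡⟨ cong (m *_) p ⟩
        m * (Φ + s′)           ≡⟨ *-distribˡ-+ m Φ s′ ⟩
        m * Φ + m * s′         ≡⟨ cong (m * Φ +_) q ⟩
        m * Φ + suc m * s      ≡⟨ +-assoc (m * Φ) s (m * s) ⟨
        m * Φ + s + m * s      ∎)
        where open ≡-Reasoning

    -- Each end loses `1/(m + 2)` of its weight.
    blue-potential : (2 + m) * potential c-blue + edgeWeight c (i , j) ≡ (2 + m) * potential c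
    blue-potential = balance (potential c) (potential c-blue) (edgeWeight c (i , j)) (edgeWeight c-blue (i , j))
      (potential-update blue) (scaled (2 + m) (suc m) (weight c-blue i) (weight c-blue j) blueˡ blueʳ)
      where
      balance : ∀ Φ Φ′ s s′ → Φ′ + s ≡ Φ + s′ → (2 + m) * s′ ≡ suc m * s → (2 + m) * Φ′ + s ≡ (2 + m) * Φ
      balance Φ Φ′ s s′ p q = +-cancelʳ-≡ (suc m * s) _ _ (begin
        (2 + m) * Φ′ + s + suc m * s  ≡⟨ +-assoc ((2 + m) * Φ′) s (suc m * s) ⟩
        (2 + m) * Φ′ + (2 + m) * s    ≡⟨ *-distribˡ-+ (2 + m) Φ′ s ⟨
        (2 + m) * (Φ′ + s)            ≡⟨ cong ((2 + m) *_) p ⟩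
        (2 + m) * (Φ + s′)            ≡⟨ *-distribˡ-+ (2 + m) Φ s′ ⟩
        (2 + m) * Φ + (2 + m) * s′    ≡⟨ cong ((2 + m) * Φ +_) q ⟩
        (2 + m) * Φ + suc m * s       ∎)
        where open ≡-Reasoning

    weight-red : ∀ v → m * weight c-red v ≤ suc m * weight c v
    weight-red v with v ≟ i | v ≟ j
    ... | yes refl | _        = ≤-reflexive redˡ
    ... | no _     | yes refl = ≤-reflexive redʳ
    ... | no v≢i   | no v≢j   =
      ≤-trans (≤-reflexive (cong (m *_) (weight-elsewhere red v v≢i v≢j))) (m≤n+m _ (weight c v))

    private
      shrink : ∀ {x y} → (2 + m) * x ≡ suc m * y → x ≤ y
      shrink {x} {y} eq = *-cancelˡ-≤ (2 + m) (≤-trans (≤-reflexive eq) (m≤n+m _ y))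

    weight-blue : ∀ v → weight c-blue v ≤ weight c v
    weight-blue v with v ≟ i | v ≟ j
    ... | yes refl | _        = shrink blueˡ
    ... | no _     | yes refl = shrink blueʳ
    ... | no v≢i   | no v≢j   = ≤-reflexive (weight-elsewhere blue v v≢i v≢j)

    -- An edge sharing an end with Alice's edge becomes heavier, by a factor of at most
    -- `(m + 1) / m`; `red-budget` takes this as its bound on `t′`.
    edgeWeight-red : ∀ e → m * edgeWeight c-red e ≤ suc m * edgeWeight c e
    edgeWeight-red (u , v) = begin
      m * edgeWeight c-red (u , v)                 ≡⟨ *-distribˡ-+ m (weight c-red u) (weight c-red v) ⟩
      m * weight c-red u + m * weight c-red v      ≤⟨ +-mono-≤ (weight-red u) (weight-red v) ⟩
      suc m * weight c u + suc m * weight c v      ≡⟨ *-distribˡ-+ (suc m) (weight c u) (weight c v) ⟨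
      suc m * edgeWeight c (u , v)                 ∎
      where open ≤-Reasoning

    edgeWeight-blue : ∀ e → edgeWeight c-blue e ≤ edgeWeight c e
    edgeWeight-blue (u , v) = +-mono-≤ (weight-blue u) (weight-blue v)

    blue-potential-≤ : potential c-blue ≤ potential c
    blue-potential-≤ = *-cancelˡ-≤ (2 + m) (≤-trans (m≤m+n _ _) (≤-reflexive blue-potential))

-- Bob's strategy and its invariants.

free-after : ∀ {n} (c : Colouring n) {i j x} → x ≢ none → ∀ e → Free (paint c i j x) e → Free c e
free-after c {i} {j} {x} x≢none (a , b) (a<b , eq) with a ≟ i | b ≟ j
... | yes _ | yes _ = contradiction eq x≢none
... | yes _ | no _  = a<b , eq
... | no _  | _     = a<b , eq

module Strategy
  (A B C p q l : ℕ) .{{_ : NonZero (l + p)}}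
  (m*A≡ : (l + p) * A ≡ suc (l + p) * C) (2+m*B≡ : (2 + (l + p)) * B ≡ suc (l + p) * C)
  (advantage : (2 + (l + p)) * p ≤ l * q) (0<p : 0 < p) (0<q : 0 < q)
  {n : ℕ} (W : Colouring n → Set) (Φ₀ : ℕ) where

  m : ℕ
  m = l + p

  open Potential A B C m m*A≡ 2+m*B≡

  module _ (win : ∀ c → Full c → potential c ≤ Φ₀ → W c) where

    not-full : ∀ {c : Colouring n} {e} → Free c e → ¬ Full c
    not-full (i<j , cij≡none) full = full _ _ i<j cij≡none

    -- The local `l` starts each turn at the module's `l` and grows by one per red edge, keeping
    -- `l + suc k ≡ m`. The strict bound by `fuel` rules out `fuel = 0`.
    alice-turn : ∀ fuel c l k → ∑ (deg c none) < fuel → l + suc k ≡ m → potential c ≤ Φ₀ →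
      (∀ e → Free c e → l * potential c + suc k * edgeWeight c e ≤ l * Φ₀) →
      BobWins p q n W c alice (suc k)

    -- `i` counts the edges already taken in this turn; the drop so far leaves room for `i` times
    -- any edge still free.
    bob-turn : ∀ fuel c i k → ∑ (deg c none) < fuel → i + suc k ≡ q → potential c ≤ Φ₀ →
      (∀ e → Free c e → (2 + m) * potential c + i * edgeWeight c e ≤ (2 + m) * Φ₀) →
      BobWins p q n W c bob (suc k)

    alice-turn (suc fuel) c l k <fuel l+k≡m Φ≤Φ₀ inv with full-or-heaviest c (edgeWeight c)
    ... | inj₁ full = finished full (win c full Φ≤Φ₀)
    ... | inj₂ (_ , free , _) = aliceMove k (not-full free)
        (λ i j i<j cij≡none → reply i j (i<j , cij≡none) k l+k≡m inv)
      where
      reply : ∀ i j (free : Free c (i , j)) k → l + suc k ≡ m →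
        (∀ e → Free c e → l * potential c + suc k * edgeWeight c e ≤ l * Φ₀) →
        BobWins p q n W (paint c i j red) (nextPlayer alice k) (nextCount p q alice k)
      reply i j free = continue
        where
        open Paint c free
        c′ : Colouring n
        c′ = paint c i j red
        <fuel′ : ∑ (deg c′ none) < fuel
        <fuel′ = <-≤-trans (∑-deg-none-decreases c free (λ ())) (m<1+n⇒m≤n <fuel)
        -- Abstracting `k` anew lets `nextPlayer` and `nextCount` compute after the case split.
        continue : ∀ k → l + suc k ≡ m →
          (∀ e → Free c e → l * potential c + suc k * edgeWeight c e ≤ l * Φ₀) →
          BobWins p q n W c′ (nextPlayer alice k) (nextCount p q alice k)
        continue zero eq inv = bob-start q refl 0<q
          where
          Φ′≤ : potential c′ ≤ Φ₀
          Φ′≤ = red-potential-≤ {l} {0} eq red-potential Φ≤Φ₀ (inv _ free)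
          -- The quota is abstracted to expose its successor form. At `i = 0` Bob's invariant is
          -- just `Φ′≤`.
          bob-start : ∀ r → r ≡ q → 0 < r → BobWins p q n W c′ bob r
          bob-start (suc r) eq′ _ = bob-turn fuel c′ 0 r <fuel′ eq′ Φ′≤ λ e _ →
            ≤-trans (≤-reflexive (+-identityʳ _)) (*-monoʳ-≤ (2 + m) Φ′≤)
        continue (suc k) eq inv = alice-turn fuel c′ (suc l) k <fuel′ (trans (sym (+-suc l (suc k))) eq)
          (red-potential-≤ {l} {suc k} eq red-potential Φ≤Φ₀ (inv _ free))
          (λ e free′ → red-budget {l} {suc k} eq red-potential (edgeWeight-red e) Φ≤Φ₀ (inv _ free)
                         (inv e (free-after c (λ ()) e free′)))

    bob-turn (suc fuel) c i k <fuel i+k≡q Φ≤Φ₀ inv with full-or-heaviest c (edgeWeight c)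
    ... | inj₁ full = finished full (win c full Φ≤Φ₀)
    ... | inj₂ ((a , b) , free , heaviest) = bobMove k (not-full free)
        (a , b , proj₁ free , proj₂ free , continue k i+k≡q)
      where
      open Paint c free
      c′ : Colouring n
      c′ = paint c a b blue
      <fuel′ : ∑ (deg c′ none) < fuel
      <fuel′ = <-≤-trans (∑-deg-none-decreases c free (λ ())) (m<1+n⇒m≤n <fuel)
      Φ′≤ : potential c′ ≤ Φ₀
      Φ′≤ = ≤-trans blue-potential-≤ Φ≤Φ₀
      inv′ : ∀ e → Free c′ e → (2 + m) * potential c′ + suc i * edgeWeight c′ e ≤ (2 + m) * Φ₀
      inv′ e free′ = blue-budget {2 + m} {i} {potential c} {potential c′} {Φ₀} blue-potential (heaviest e was-free)
                       (edgeWeight-blue e) (inv e was-free)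
        where
        was-free : Free c e
        was-free = free-after c (λ ()) e free′
      continue : ∀ k → i + suc k ≡ q → BobWins p q n W c′ (nextPlayer bob k) (nextCount p q bob k)
      continue zero eq = alice-start p refl 0<p
        where
        alice-start : ∀ r → r ≡ p → 0 < r → BobWins p q n W c′ alice r
        -- Bob's turn is complete, `i + 1 = q`, so his whole budget can be exchanged for Alice's.
        alice-start (suc r) eq′ _ = alice-turn fuel c′ l r <fuel′ (cong (l +_) eq′) Φ′≤ λ e free′ →
          exchange-budget {2 + m} {l} {suc r} {q}
            (subst (λ p′ → (2 + m) * p′ ≤ l * q) (sym eq′) advantage)
            (subst (λ i → (2 + m) * potential c′ + i * edgeWeight c′ e ≤ (2 + m) * Φ₀)
              (trans (+-comm 1 i) eq) (inv′ e free′))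
      continue (suc k) eq = bob-turn fuel c′ (suc i) k <fuel′ (trans (sym (+-suc i (suc k))) eq) Φ′≤ inv′

-- The final estimate and the choice of constants.

-- With d + 1 vertices the blank potential is (d + 1) C^d and an edge weighs 2 C^d,
-- whence the bound (d + 3) C^d.
module _ (A B C : ℕ) .{{_ : NonZero C}} (AB≡ : A * B ≡ C * suc C) (B≤A : B ≤ A) where

  -- If `b ≤ r`, the square of the weight is at least `(A * B) ^ d = C ^ d * suc C ^ d`, which by
  -- `growth` exceeds the square of the bound.
  red-majority-heavy : ∀ {r b d} → r + b ≡ d → b ≤ r → (d + 3) * (d + 3) * C ^ d < suc C ^ d →
    (d + 3) * C ^ d < A ^ r * B ^ b
  red-majority-heavy {r} {b} {d} r+b≡d b≤r growth = ≰⇒> λ w≤ → <⇒≱ growth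
    (*-cancelˡ-≤ (C ^ d) {{m^n≢0 C d}} (begin
      C ^ d * suc C ^ d                              ≡⟨ [a*b]^k≡a^k*b^k C (suc C) d ⟨
      (C * suc C) ^ d                                ≡⟨ cong₂ _^_ (sym AB≡) (sym r+b≡d) ⟩
      (A * B) ^ (r + b)                              ≤⟨ [ab]^[r+s]≤[a^r*b^s]² {A} {B} {r} {b} B≤A b≤r ⟩
      A ^ r * B ^ b * (A ^ r * B ^ b)                ≤⟨ *-mono-≤ w≤ w≤ ⟩
      (d + 3) * C ^ d * ((d + 3) * C ^ d)            ≡⟨ r₁ (d + 3) (C ^ d) ⟩
      C ^ d * ((d + 3) * (d + 3) * C ^ d)            ∎))
    where
    open ≤-Reasoning
    r₁ : ∀ x y → x * y * (x * y) ≡ y * (x * x * y)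
    r₁ = solve-∀

theorem3p1 : (p q : ℕ) → 1 ≤ p → p < q →
    Σ ℕ (λ N → (n : ℕ) → N ≤ n →
    Player2Wins p q n StarBobWin × Player2Wins p q n CaptureBobWin)
theorem3p1 p@(suc p-1) q 0<p p<q = suc (proj₁ growth) , λ
  -- The growth threshold concerns the degree `d = n - 1`, hence the shift by one.
  { (suc d) (s≤s N≤d) →
      bob-wins d N≤d (λ c → BlueMajority⇒StarBobWin c)
    , bob-wins d N≤d (λ c → BlueMajority⇒CaptureBobWin c) }
  where
  l m A B C : ℕ
  -- This choice gives `(2 + m) * p = l * (p + 1)`, so `advantage` reduces to `p + 1 ≤ q`.
  l = p * (p + 2)
  m = l + p
  A = (1 + m) * (2 + m)
  B = m * (1 + m)
  C = m * (2 + m)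

  growth : ∃ λ N → ∀ d → N ≤ d → (d + 3) * (d + 3) * C ^ d < suc C ^ d
  growth = exponential-growth C

  m*A≡ : m * A ≡ suc m * C
  m*A≡ = r m
    where
    r : ∀ m → m * ((1 + m) * (2 + m)) ≡ suc m * (m * (2 + m))
    r = solve-∀
  2+m*B≡ : (2 + m) * B ≡ suc m * C
  2+m*B≡ = r m
    where
    r : ∀ m → (2 + m) * (m * (1 + m)) ≡ suc m * (m * (2 + m))
    r = solve-∀
  AB≡ : A * B ≡ C * suc C
  AB≡ = r m
    where
    r : ∀ m → (1 + m) * (2 + m) * (m * (1 + m)) ≡ m * (2 + m) * suc (m * (2 + m))
    r = solve-∀
  B≤A : B ≤ A
  B≤A = ≤-trans (≤-reflexive (*-comm m (1 + m))) (*-monoʳ-≤ (1 + m) (m≤n+m m 2))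

  advantage : (2 + m) * p ≤ l * q
  advantage = ≤-trans (≤-reflexive (r p)) (*-monoʳ-≤ l p<q)
    where
    r : ∀ p → (2 + (p * (p + 2) + p)) * p ≡ p * (p + 2) * suc p
    r = solve-∀

  module _ (d : ℕ) (N≤d : proj₁ growth ≤ d) {W : Colouring (suc d) → Set}
           (majority⇒W : ∀ c → BlueMajority c → W c) where

    Φ₀ : ℕ
    Φ₀ = (d + 3) * C ^ d

    open Potential A B C m m*A≡ 2+m*B≡
    open Strategy A B C p q l m*A≡ 2+m*B≡ advantage 0<p (≤-<-trans z≤n p<q) W Φ₀
      using (alice-turn)

    weight-blank : ∀ v → weight {suc d} blank v ≡ C ^ d
    weight-blank v = trans
      (cong₂ (λ r b → monomial r b (deg blank none v)) red≡0 blue≡0)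
      (trans (+-identityʳ _) (cong (C ^_) none≡d))
      where
      red≡0 : deg blank red v ≡ 0
      red≡0 = deg-blank red (λ ()) v
      blue≡0 : deg blank blue v ≡ 0
      blue≡0 = deg-blank blue (λ ()) v
      none≡d : deg blank none v ≡ d
      none≡d = trans (sym (cong₂ (λ r b → r + b + deg blank none v) red≡0 blue≡0)) (deg-sum blank v)

    potential-blank : potential {suc d} blank ≡ suc d * C ^ d
    potential-blank = trans (∑-cong weight-blank) (∑-const (suc d) (C ^ d))

    -- With no free edge left, a vertex weight is `A ^ r * B ^ b` and is bounded by the potential,
    -- so a vertex without blue majority would be too heavy.
    win : ∀ c → Full c → potential c ≤ Φ₀ → W c
    win c full Φ≤Φ₀ = majority⇒W c λ v → ≰⇒> λ b≤r →
      <⇒≱ (red-majority-heavy A B C AB≡ B≤A (r+b≡d v) b≤r (proj₂ growth d N≤d))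
        (≤-trans (≤-reflexive (weight≡ v)) (≤-trans (≤∑ (weight c) v) Φ≤Φ₀))
      where
      r+b≡d : ∀ v → deg c red v + deg c blue v ≡ d
      r+b≡d v = trans (sym (trans (cong (deg c red v + deg c blue v +_) (Full⇒deg-none≡0 full v)) (+-identityʳ _)))
                  (deg-sum c v)
      weight≡ : ∀ v → A ^ deg c red v * B ^ deg c blue v ≡ weight c v
      weight≡ v = trans (sym (*-identityʳ _))
        (cong (λ u → A ^ deg c red v * B ^ deg c blue v * C ^ u) (sym (Full⇒deg-none≡0 full v)))

    bob-wins : Player2Wins p q (suc d) W
    -- `≤-refl` fixes the fuel as one more than the sum of the free degrees.
    bob-wins = alice-turn win _ blank l p-1 ≤-refl refl
      (≤-trans (≤-reflexive potential-blank) (*-monoˡ-≤ (C ^ d) (≤-trans (m≤n+m (suc d) 2) (≤-reflexive (+-comm 3 d)))))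
      λ { (u , v) _ → start (weight-blank u) (weight-blank v) }
      where
      start : ∀ {x y} → x ≡ C ^ d → y ≡ C ^ d → l * potential {suc d} blank + p * (x + y) ≤ l * Φ₀
      start refl refl = begin
        l * potential {suc d} blank + p * (C ^ d + C ^ d)
          -- Since `p ≤ l`, the reserve for Alice's first turn costs at most two further copies of
          -- `C ^ d` in `Φ₀`.
          ≤⟨ +-mono-≤ (≤-reflexive (cong (l *_) potential-blank)) (*-monoˡ-≤ (C ^ d + C ^ d) (m≤m*n p (p + 2))) ⟩
        l * (suc d * C ^ d) + l * (C ^ d + C ^ d)  ≡⟨ r l d (C ^ d) ⟩
        l * Φ₀ ∎
        where
        open ≤-Reasoning
        r : ∀ l d x → l * (suc d * x) + l * (x + x) ≡ l * ((d + 3) * x)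
        r = solve-∀
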